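{- For every message $M$ and formula $\phi$: $\vdash\neg\langle M\rangle\phi\leftrightarrow\neg[M]\phi$.
   Context: Fix a finite set $\mathcal{A}$ of agent names containing a distinguished name $\mathsf{CM}$. Messages: $M ::= a \mid B \mid (M,M)$ ($a\in\mathcal{A}$, $B$ optional data constants, pairs). $\mathcal{P}$ is a denumerable set of propositional variables containing atoms $\mathsf{k}_a(M)$ ("$a$ knows $M$"). Formulas: $\phi ::= P \mid \phi\wedge\phi \mid \phi\vee\phi \mid \neg\phi \mid \phi\to\phi \mid [M]\phi$. Abbreviations: $\mathrm{true}:=\mathsf{k}_{\mathsf{CM}}(\mathsf{CM})$, $\mathrm{false}:=\neg\mathrm{true}$, $\phi\leftrightarrow\psi:=(\phi\to\psi)\wedge(\psi\to\phi)$, $\langle M\rangle\phi:=\neg\neg(\mathsf{k}_{\mathsf{CM}}(M)\wedge\phi)$. LIiP is the smallest set of formulas containing all instances of: the axioms of an adequate Hilbert axiomatization of intuitionistic propositional logic; $\mathsf{k}_a(a)$; $(\mathsf{k}_a(M)\wedge\mathsf{k}_a(M'))\leftrightarrow\mathsf{k}_a((M,M'))$; $[M]\mathsf{k}_{\mathsf{CM}}(M)$; $[M](\phi\to\psi)\to([M]\phi\to[M]\psi)$; $[M]\phi\to(\mathsf{k}_{\mathsf{CM}}(M)\to\phi)$; $[M]\phi\to\langle M\rangle\phi$; $\phi\to[M]\phi$; and closed under modus ponens and the rule: if $\mathsf{k}_{\mathsf{CM}}(M)\to\mathsf{k}_{\mathsf{CM}}(M')$ is in the set then so is $[M']\phi\to[M]\phi$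 for every $\phi$. Write $\vdash\phi$ for $\phi\in\mathrm{LIiP}$. -}

module Defs where

open import Data.Fin.Base using (Fin)
open import Data.Nat.Base using (ℕ)
open import Data.Product.Base using (∃; uncurry)
open import Function.Bundles using (_↔_)
open import Function.Definitions using (Injective)
open import Relation.Binary.PropositionalEquality.Core using (_≡_)

data Msg (Agent Datum : Set) : Set where
  agent : Agent → Msg Agent Datum
  datum : Datum → Msg Agent Datum
  pair  : Msg Agent Datum → Msg Agent Datum → Msg Agent Datum

-- Data constants are optional: Datum may be empty.
-- The atoms k a M are part of the syntax, so distinct pairs (a , M) name
-- distinct variables; hence k-injective.
record Signature : Set₁ where
  field
    Agent          : Set
    agents-finite  : ∃ λ n → Agent ↔ Fin n
    CM             : Agent
    Datum          : Set
    Var            : Set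
    var-denumerable : Var ↔ ℕ
    k              : Agent → Msg Agent Datum → Var
    k-injective    : Injective _≡_ _≡_ (uncurry k)

module LIiP (S : Signature) where
  open Signature S

  Message : Set
  Message = Msg Agent Datum

  infix  9 ¬_ [_]_ ⟨_⟩_
  infixr 8 _∧_
  infixr 7 _∨_
  infixr 6 _⇒_
  infix  5 _⇔_
  infix  4 ⊢_

  data Formula : Set where
    var  : Var → Formula
    _∧_  : Formula → Formula → Formula
    _∨_  : Formula → Formula → Formula
    ¬_   : Formula → Formula
    _⇒_  : Formula → Formula → Formula
    [_]_ : Message → Formula → Formula

  knows : Agent → Message → Formula
  knows a M = var (k a M)

  true : Formula
  true = knows CM (agent CM)

  false : Formula
  false = ¬ true

  _⇔_ : Formula → Formula → Formula
  φ ⇔ ψ = (φ ⇒ ψ) ∧ (ψ ⇒ φ)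

  ⟨_⟩_ : Message → Formula → Formula
  ⟨ M ⟩ φ = ¬ ¬ (knows CM M ∧ φ)

  -- Kleene's Hilbert axioms for intuitionistic propositional logic.  Negation
  -- is a primitive connective here, so it has its own axioms ¬-intro, ¬-elim.
  data IPCAxiom : Formula → Set where
    ⇒-const  : ∀ φ ψ → IPCAxiom (φ ⇒ (ψ ⇒ φ))
    ⇒-distr  : ∀ φ ψ χ → IPCAxiom ((φ ⇒ (ψ ⇒ χ)) ⇒ ((φ ⇒ ψ) ⇒ (φ ⇒ χ)))
    ∧-elimˡ  : ∀ φ ψ → IPCAxiom ((φ ∧ ψ) ⇒ φ)
    ∧-elimʳ  : ∀ φ ψ → IPCAxiom ((φ ∧ ψ) ⇒ ψ)
    ∧-intro  : ∀ φ ψ → IPCAxiom (φ ⇒ (ψ ⇒ (φ ∧ ψ)))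
    ∨-introˡ : ∀ φ ψ → IPCAxiom (φ ⇒ (φ ∨ ψ))
    ∨-introʳ : ∀ φ ψ → IPCAxiom (ψ ⇒ (φ ∨ ψ))
    ∨-elim   : ∀ φ ψ χ → IPCAxiom ((φ ⇒ χ) ⇒ ((ψ ⇒ χ) ⇒ ((φ ∨ ψ) ⇒ χ)))
    ¬-intro  : ∀ φ ψ → IPCAxiom ((φ ⇒ ψ) ⇒ ((φ ⇒ (¬ ψ)) ⇒ (¬ φ)))
    ¬-elim   : ∀ φ ψ → IPCAxiom ((¬ φ) ⇒ (φ ⇒ ψ))

  data ⊢_ : Formula → Set where
    ipc          : ∀ {φ} → IPCAxiom φ → ⊢ φ
    own-name     : ∀ a → ⊢ knows a (agent a)
    pairing      : ∀ a M M′ →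
                   ⊢ (knows a M ∧ knows a M′) ⇔ knows a (pair M M′)
    self-know    : ∀ M → ⊢ [ M ] knows CM M
    □-distr      : ∀ M φ ψ → ⊢ ([ M ] (φ ⇒ ψ)) ⇒ (([ M ] φ) ⇒ ([ M ] ψ))
    □-truth      : ∀ M φ → ⊢ ([ M ] φ) ⇒ (knows CM M ⇒ φ)
    □-consistent : ∀ M φ → ⊢ ([ M ] φ) ⇒ (⟨ M ⟩ φ)
    □-intro      : ∀ M φ → ⊢ φ ⇒ ([ M ] φ)
    mp           : ∀ {φ ψ} → ⊢ φ → ⊢ φ ⇒ ψ → ⊢ ψ
    antitone     : ∀ {M M′} → ⊢ knows CM M ⇒ knows CM M′ →
                   ∀ φ → ⊢ ([ M′ ] φ) ⇒ ([ M ] φ)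

{-# OPTIONS --safe #-}
-- One direction contraposes [M]φ → ⟨M⟩φ.  For the other, contrapose
-- k_CM(M) ∧ φ → φ → [M]φ and use that ¬ψ implies ¬¬¬ψ; the axiom φ → [M]φ
-- is what makes the conjunct k_CM(M) in ⟨M⟩φ irrelevant.
module Submission where

open import Defs

module Derivations (S : Signature) where
  open LIiP S

  ap : ∀ {φ ψ χ} → ⊢ φ ⇒ (ψ ⇒ χ) → ⊢ φ ⇒ ψ → ⊢ φ ⇒ χ
  ap φ⇒ψ⇒χ φ⇒ψ = mp φ⇒ψ (mp φ⇒ψ⇒χ (ipc (⇒-distr _ _ _)))

  weaken : ∀ {φ ψ} → ⊢ ψ → ⊢ φ ⇒ ψ
  weaken ψ = mp ψ (ipc (⇒-const _ _))

  ⇒-trans : ∀ {φ ψ χ} → ⊢ φ ⇒ ψ → ⊢ ψ ⇒ χ → ⊢ φ ⇒ χ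
  ⇒-trans φ⇒ψ ψ⇒χ = ap (weaken ψ⇒χ) φ⇒ψ

  -- The combinator identity I = S K K, with `ap` as S and `⇒-const` as K.
  ⇒-refl : ∀ {φ} → ⊢ φ ⇒ φ
  ⇒-refl {φ} = ap (ipc (⇒-const φ (φ ⇒ φ))) (ipc (⇒-const φ φ))

  contrapose : ∀ {φ ψ} → ⊢ φ ⇒ ψ → ⊢ (¬ ψ) ⇒ (¬ φ)
  contrapose {φ} {ψ} φ⇒ψ =
    ⇒-trans (ipc (⇒-const (¬ ψ) φ)) (mp φ⇒ψ (ipc (¬-intro φ ψ)))

  -- Given `φ`, the assumption `¬ φ` yields both `φ` and `¬ φ`, so `¬-intro` refutes it.
  ¬¬-intro : ∀ {φ} → ⊢ φ ⇒ (¬ (¬ φ))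
  ¬¬-intro {φ} =
    ap (⇒-trans (ipc (⇒-const φ (¬ φ))) (ipc (¬-intro (¬ φ) φ)))
       (weaken ⇒-refl)

  ⇔-intro : ∀ {φ ψ} → ⊢ φ ⇒ ψ → ⊢ ψ ⇒ φ → ⊢ φ ⇔ ψ
  ⇔-intro φ⇒ψ ψ⇒φ = mp ψ⇒φ (mp φ⇒ψ (ipc (∧-intro _ _)))

theorem2p14 : (S : Signature) → let open LIiP S in
    (M : Message) (φ : Formula) →
    ⊢ (¬ (⟨ M ⟩ φ)) ⇔ (¬ ([ M ] φ))
theorem2p14 S M φ = ⇔-intro
    (contrapose (□-consistent M φ))
    -- The conclusion `¬ (⟨ M ⟩ φ)` unfolds to `¬ ¬ ¬ (knows CM M ∧ φ)`, so `¬¬-intro` is taken at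
    -- `¬ (knows CM M ∧ φ)`.
    (⇒-trans (contrapose (⇒-trans (ipc (∧-elimʳ _ _)) (□-intro M φ))) ¬¬-intro)
  where
  open LIiP S
  open Derivations S
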